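{- Let $a,m\ge 2$ and $\tau=12\cdots(m-1)m^a$. If $n\ge a+m-1$, then the total number of occurrences of the subword $\tau$ within all the members of $NC_n$, i.e. $\sum_{\pi\in NC_n}\mu_\tau(\pi)$, is $\frac{r}{2r+m}\binom{2r+m}{r}$, where $r=n-a-m+2$.
   Context: A set partition of $[n]=\{1,\dots,n\}$ with blocks $B_1,\dots,B_k$ ordered so that $\min B_1<\cdots<\min B_k$ is represented by its canonical sequential form $\pi=\pi_1\cdots\pi_n$, where $i\in B_{\pi_i}$ for each $i$. It is non-crossing if $\pi$ contains no (not necessarily consecutive) subsequence of the form $a\,b\,a\,b$ with $a<b$. $NC_n$ denotes the set of non-crossing partitions of $[n]$, identified with their canonical sequential forms. An occurrence of a word $\tau=\tau_1\cdots\tau_k$ as a subword in a sequence $\sigma_1\cdots\sigma_n$ is an index $i\in[n-k+1]$ such that the string of consecutive letters $\sigma_i\cdots\sigma_{i+k-1}$ is order-isomorphic to $\tau$ (same relative order, including equalities). $\mu_\tau(\pi)$ denotes the number of occurrences of $\tau$ in $\pi$. Here $12\cdots(m-1)m^a$ denotes $1,2,\dots,m-1$ followed by $a$ copies of $m$. -}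

module Defs where

open import Data.Nat.Base as ℕ using (ℕ; zero; suc; _∸_; _≤_; NonZero; >-nonZero)
import Data.Nat.Properties as ℕ
open import Data.Fin.Base using (Fin; toℕ; cast; _<_) renaming (_≤_ to _≤ᶠ_)
open import Data.Fin.Properties using (any?; all?; _≟_; _<?_; _≤?_)
open import Data.Fin.Subset using (Subset; _∈_; Nonempty)
open import Data.Fin.Subset.Properties using (_∈?_; nonempty?; ⊆-antisym)
open import Data.List.Base as List
  using (List; [_]; _++_; length; map; filter; concatMap; upTo; allFin;
         replicate; take; drop; cartesianProductWith)
open import Data.Nat.ListAction using (sum)
open import Data.Vec.Base as Vec using (Vec; []; _∷_)
open import Data.Vec.Properties using (lookup∘tabulate; []=⇒lookup; lookup⇒[]=)
open import Data.Product.Base using (Σ; ∃; ∃₂; _×_; _,_; proj₁)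
open import Function.Base using (_∘_)
open import Function.Bundles using (_⇔_; mk⇔; Equivalence)
open import Relation.Binary.PropositionalEquality
  using (_≡_; refl; sym; trans; subst; subst₂)
open import Relation.Nullary.Decidable
  using (Dec; yes; no; does; map′; _×-dec_; _→-dec_; ¬?; dec-true)
open import Relation.Nullary.Negation.Core using (¬_)

private
  variable
    n k : ℕ

-- Positions are elements of Fin n, i.e. [n] shifted down by one.

IsMin : Subset n → Fin n → Set
IsMin p i = i ∈ p × (∀ i′ → i′ ∈ p → i ≤ᶠ i′)

record IsSetPartition (B : Fin k → Subset n) : Set where
  field
    nonempty : ∀ j → Nonempty (B j)
    disjoint : ∀ i j j′ → i ∈ B j → i ∈ B j′ → j ≡ j′
    cover    : ∀ i → ∃ λ j → i ∈ B j

MinOrdered : (Fin k → Subset n) → Set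
MinOrdered B = ∀ j j′ → j < j′ → ∃₂ λ i i′ → IsMin (B j) i × IsMin (B j′) i′ × i < i′

-- w = π₁ ⋯ πₙ with i ∈ B_{πᵢ} for every i.
CanonicalFormOf : (Fin k → Subset n) → Vec (Fin k) n → Set
CanonicalFormOf B w = ∀ i → i ∈ B (Vec.lookup w i)

IsCanonicalForm : Vec (Fin k) n → Set
IsCanonicalForm {k} {n} w =
  Σ (Fin k → Subset n) λ B → IsSetPartition B × MinOrdered B × CanonicalFormOf B w

NonCrossing : Vec (Fin k) n → Set
NonCrossing w = ¬ (∃ λ p → ∃ λ q → ∃ λ r → ∃ λ s →
  p < q × q < r × r < s ×
  Vec.lookup w p ≡ Vec.lookup w r × Vec.lookup w q ≡ Vec.lookup w s ×
  Vec.lookup w p < Vec.lookup w q)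

-- A word can be the canonical form of only one family of blocks, so it
-- suffices to test this one.
blocks : Vec (Fin k) n → Fin k → Subset n
blocks w j = Vec.tabulate λ i → does (Vec.lookup w i ≟ j)

∈-blocks⁺ : ∀ (w : Vec (Fin k) n) {i j} → Vec.lookup w i ≡ j → i ∈ blocks w j
∈-blocks⁺ w {i} {j} eq =
  lookup⇒[]= i _ (trans (lookup∘tabulate _ i) (dec-true (Vec.lookup w i ≟ j) eq))

∈-blocks⁻ : ∀ (w : Vec (Fin k) n) {i j} → i ∈ blocks w j → Vec.lookup w i ≡ j
∈-blocks⁻ w {i} {j} i∈ with Vec.lookup w i ≟ j | trans (sym (lookup∘tabulate _ i)) ([]=⇒lookup i∈)
... | yes eq | _  = eq
... | no _   | ()

blocks-unique : ∀ {B : Fin k → Subset n} {w} → IsSetPartition B → CanonicalFormOf B w →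
                ∀ j → B j ≡ blocks w j
blocks-unique {B = B} {w} P c j = ⊆-antisym
  (λ {i} i∈B → ∈-blocks⁺ w (IsSetPartition.disjoint P i (Vec.lookup w i) j (c i) i∈B))
  (λ {i} i∈b → subst (λ l → i ∈ B l) (∈-blocks⁻ w i∈b) (c i))

isMin? : (p : Subset n) (i : Fin n) → Dec (IsMin p i)
isMin? p i = (i ∈? p) ×-dec all? λ i′ → (i′ ∈? p) →-dec (i ≤? i′)

minOrdered? : (B : Fin k → Subset n) → Dec (MinOrdered B)
minOrdered? B = all? λ j → all? λ j′ → (j <? j′) →-dec
  any? λ i → any? λ i′ → isMin? (B j) i ×-dec isMin? (B j′) i′ ×-dec (i <? i′)

isCanonicalForm? : (w : Vec (Fin k) n) → Dec (IsCanonicalForm w)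
isCanonicalForm? w = map′ to from
  (all? (λ j → nonempty? (blocks w j)) ×-dec minOrdered? (blocks w))
  where
  to : (∀ j → Nonempty (blocks w j)) × MinOrdered (blocks w) → IsCanonicalForm w
  to (ne , mo) = blocks w , record
    { nonempty = ne
    ; disjoint = λ i j j′ p q → trans (sym (∈-blocks⁻ w p)) (∈-blocks⁻ w q)
    ; cover    = λ i → Vec.lookup w i , ∈-blocks⁺ w refl
    } , mo , λ i → ∈-blocks⁺ w refl

  from : IsCanonicalForm w → (∀ j → Nonempty (blocks w j)) × MinOrdered (blocks w)
  from (B , P , mo , c) =
    (λ j → subst Nonempty (eq j) (IsSetPartition.nonempty P j)) ,
    (λ j j′ j<j′ → subst₂ (λ p q → ∃₂ λ i i′ → IsMin p i × IsMin q i′ × i < i′)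
                     (eq j) (eq j′) (mo j j′ j<j′))
    where
    eq : ∀ j → B j ≡ blocks w j
    eq = blocks-unique {w = w} P c

nonCrossing? : (w : Vec (Fin k) n) → Dec (NonCrossing w)
nonCrossing? w = ¬? (any? λ p → any? λ q → any? λ r → any? λ s →
  (p <? q) ×-dec (q <? r) ×-dec (r <? s) ×-dec
  (Vec.lookup w p ≟ Vec.lookup w r) ×-dec (Vec.lookup w q ≟ Vec.lookup w s) ×-dec
  (Vec.lookup w p <? Vec.lookup w q))

words : ∀ k n → List (Vec (Fin k) n)
words k zero    = [ [] ]
words k (suc n) = cartesianProductWith _∷_ (allFin k) (words k n)

-- The letters of a word, numbered from 1.
letters : Vec (Fin k) n → List ℕ
letters w = map (suc ∘ toℕ) (Vec.toList w)

-- A partition of [n] has at most n blocks.  All blocks being nonempty, a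
-- word is a canonical form for only one k, so no partition is listed twice.
NC : ℕ → List (List ℕ)
NC n = concatMap
  (λ k → map letters (filter (λ w → isCanonicalForm? w ×-dec nonCrossing? w) (words k n)))
  (upTo (suc n))

OrderIsomorphic : List ℕ → List ℕ → Set
OrderIsomorphic u v = Σ (length u ≡ length v) λ eq → ∀ p q →
  (List.lookup u p ℕ.< List.lookup u q ⇔
     List.lookup v (cast eq p) ℕ.< List.lookup v (cast eq q)) ×
  (List.lookup u p ≡ List.lookup u q ⇔
     List.lookup v (cast eq p) ≡ List.lookup v (cast eq q))

_⇔-dec_ : ∀ {A B : Set} → Dec A → Dec B → Dec (A ⇔ B)
a? ⇔-dec b? = map′ (λ (f , g) → mk⇔ f g) (λ e → Equivalence.to e , Equivalence.from e)
  ((a? →-dec b?) ×-dec (b? →-dec a?))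

orderIsomorphic? : ∀ u v → Dec (OrderIsomorphic u v)
orderIsomorphic? u v with length u ℕ.≟ length v
... | no ≢   = no (≢ ∘ proj₁)
... | yes eq = map′ (eq ,_) (λ (_ , f) → f) (all? λ p → all? λ q →
  ((List.lookup u p ℕ.<? List.lookup u q) ⇔-dec
     (List.lookup v (cast eq p) ℕ.<? List.lookup v (cast eq q))) ×-dec
  ((List.lookup u p ℕ.≟ List.lookup u q) ⇔-dec
     (List.lookup v (cast eq p) ℕ.≟ List.lookup v (cast eq q))))

-- Starting indices run over 0, …, n − k, and there are none when k > n.
μ : List ℕ → List ℕ → ℕ
μ τ σ = length (filter (λ i → orderIsomorphic? (take (length τ) (drop i σ)) τ)
                       (upTo (suc (length σ) ∸ length τ)))

totalOccurrences : List ℕ → ℕ → ℕ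
totalOccurrences τ n = sum (map (μ τ) (NC n))

-- 1 2 ⋯ (m−1) mᵃ
risePlateau : ℕ → ℕ → List ℕ
risePlateau m a = map suc (upTo (m ∸ 1)) ++ replicate a m

2r+m-nonZero : ∀ r {m} → 2 ≤ m → NonZero (2 ℕ.* r ℕ.+ m)
2r+m-nonZero r 2≤m =
  >-nonZero (ℕ.≤-trans (ℕ.≤-trans (ℕ.s≤s ℕ.z≤n) 2≤m) (ℕ.m≤n+m _ (2 ℕ.* r)))

{-# OPTIONS --safe #-}

-- While a non-crossing word is read, the letters that may still be repeated form
-- a stack: the next letter is either new and pushed, or already on the stack, and
-- everything above it is popped.  An ascent is a push and an equality repeats the
-- top, so an occurrence of 1 2 ⋯ (m−1) mᵃ is m − 1 pushes followed by a − 1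
-- repetitions of the top.  Whether it can start at a given letter, and in how many
-- ways the word goes on after it, depends only on the height of the stack.  This
-- gives a recursion in the height, solved by
--   C(2k+m+h, k) + (h−1) C(2k+m+h−1, k−1),
-- which for h = 1 and k = r − 1 is C(2r+m−1, r−1) = r/(2r+m) · C(2r+m, r).

module Submission where

open import Defs
open import Algebra.Properties.CommutativeSemigroup using (interchange)
open import Data.Bool.Base using (if_then_else_; true; false)
open import Data.Empty using (⊥)
open import Data.Fin.Base as Fin using (Fin; cast; toℕ; fromℕ<)
open import Data.Fin.Properties using (toℕ<n; toℕ-injective; toℕ-fromℕ<)
open import Data.Fin.Subset using (Subset; Nonempty; inside; outside) renaming (_∈_ to _∈ˢ_)
import Data.Integer.Base as ℤ
import Data.Integer.Properties as ℤ
open import Data.List.Base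
  using (List; []; _∷_; [_]; _++_; length; map; filter; upTo; applyUpTo; take; drop; replicate; lookup)
open import Data.List.Membership.Propositional using (_∈_; find; lose)
open import Data.List.Membership.Propositional.Properties
open import Data.List.Membership.Propositional.Properties.WithK using (unique∧set⇒bag)
open import Data.List.Properties
  using (map-++; map-∘; map-cong; map-applyUpTo; length-take; ∷-injectiveˡ; ∷-injectiveʳ)
open import Data.List.Relation.Binary.BagAndSetEquality using (∼bag⇒↭)
open import Data.List.Relation.Binary.Permutation.Propositional using (_↭_)
open import Data.List.Relation.Binary.Permutation.Propositional.Properties using (map⁺)
open import Data.List.Relation.Binary.Sublist.Propositional as Sublist
  using (_⊆_; []; _∷_; _∷ʳ_; minimum; to∈; from∈)
open import Data.List.Relation.Unary.All as All using (All; []; _∷_)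
import Data.List.Relation.Unary.All.Properties as All
open import Data.List.Relation.Unary.AllPairs as AllPairs using (AllPairs; []; _∷_)
import Data.List.Relation.Unary.AllPairs.Properties as AllPairs
open import Data.List.Relation.Unary.Any using (here; there)
open import Data.List.Relation.Unary.Unique.Propositional using (Unique)
import Data.List.Relation.Unary.Unique.Propositional.Properties as Unique
open import Data.Nat.Base
open import Data.Nat.Combinatorics using (_C_; nC1≡n; nCk≡nC[n∸k]; k>n⇒nCk≡0; nCk+nC[k+1]≡[n+1]C[k+1])
open import Data.Nat.ListAction using (sum)
open import Data.Nat.ListAction.Properties using (sum-++; sum-↭)
open import Data.Nat.Properties
open import Data.Nat.Tactic.RingSolver using (solve-∀)
open import Data.Product.Base using (_×_; _,_; proj₁; proj₂; ∃; ∃₂)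
import Data.Rational.Base as ℚ
import Data.Rational.Properties as ℚ
import Data.Rational.Unnormalised.Base as ℚᵘ
import Data.Rational.Unnormalised.Properties as ℚᵘ
open import Data.Sum.Base using (_⊎_; inj₁; inj₂)
open import Data.Unit.Base using (⊤; tt)
open import Data.Vec.Base as Vec using (Vec; []; _∷_)
open import Data.Vec.Properties using (∷-injective)
open import Function.Base using (_∘_; id)
open import Function.Bundles using (_⇔_; mk⇔; Equivalence)
open import Relation.Binary.Definitions using (tri<; tri≈; tri>)
open import Relation.Binary.PropositionalEquality hiding ([_])
open import Relation.Nullary.Decidable using (Dec; yes; no; does; _×-dec_; does-⇔; dec-false)
open import Relation.Nullary.Negation using (¬_; contradiction)
open import Relation.Unary using (Pred; Decidable)

-- Binomial coefficients and the recursion in the height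

-- The stack strictly decreases from its top, and this is why heights suffice: repeating the letter
-- at level `i` leaves height `i`, so each of the levels 1 to `h` is reached by exactly one
-- repetition, and a push reaches `h + 1`. The same order explains the pattern: a letter above the
-- top is not on the stack and hence new, while the letters below the top are strictly smaller than
-- it. The plateau does not change the height, so its length enters the answer only through the
-- number of letters left over.
--
-- The obstacle is that `NC` is a filter by block conditions and by positions of crossings, and
-- neither passes to a suffix unless something about the prefix is remembered. The stack and the
-- largest letter `M` are exactly that memory. Since `NC` is sorted by the number of blocks and the
-- stack lists words by their first letters, the two lists are compared as sets without repetitions,
-- which is enough for a sum.

_C⁻_ : ℕ → ℕ → ℕ
n C⁻ zero  = 0
n C⁻ suc k = n C k

-- `n C⁻ k` stands for C(n, k-1) with the value 0 at `k = 0`, where truncated subtraction would give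
-- 1. This lets the rule and the closed forms below hold for every `k`.
pascal : ∀ n k → suc n C k ≡ n C k + n C⁻ k
pascal n zero    = refl
pascal n (suc k) = trans (sym (nCk+nC[k+1]≡[n+1]C[k+1] n k)) (+-comm (n C k) _)

absorption : ∀ n k → suc k * (suc n C suc k) ≡ suc n * (n C k)
absorption n zero = trans (*-identityˡ _) (trans (nC1≡n (suc n)) (sym (*-identityʳ (suc n))))
absorption zero (suc k) =
  trans (cong (suc (suc k) *_) (k>n⇒nCk≡0 {k = suc (suc k)} (s≤s (s≤s z≤n))))
        (trans (*-zeroʳ (suc (suc k))) (sym (trans (*-identityˡ _) (k>n⇒nCk≡0 {k = suc k} (s≤s z≤n)))))
absorption (suc n) (suc k) = begin
  suc (suc k) * (suc (suc n) C suc (suc k))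
    ≡⟨ cong (suc (suc k) *_) (pascal (suc n) (suc (suc k))) ⟩
  suc (suc k) * (suc n C suc (suc k) + suc n C suc k)
    ≡⟨ split (suc k) (suc n C suc (suc k)) (suc n C suc k) ⟩
  suc (suc k) * (suc n C suc (suc k)) + (suc k * (suc n C suc k) + suc n C suc k)
    ≡⟨ cong₂ (λ x y → x + (y + suc n C suc k)) (absorption n (suc k)) (absorption n k) ⟩
  suc n * (n C suc k) + (suc n * (n C k) + suc n C suc k)
    ≡⟨ join (suc n) (n C suc k) (n C k) (suc n C suc k) ⟩
  suc n * (n C suc k + n C k) + suc n C suc k
    ≡⟨ cong (λ x → suc n * x + suc n C suc k) (sym (pascal n (suc k))) ⟩
  suc n * (suc n C suc k) + suc n C suc k
    ≡⟨ +-comm (suc n * (suc n C suc k)) _ ⟩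
  suc (suc n) * (suc n C suc k) ∎
  where
  open ≡-Reasoning
  split : ∀ k x y → suc k * (x + y) ≡ suc k * x + (k * y + y)
  split = solve-∀
  join : ∀ n x y z → n * x + (n * y + z) ≡ n * (x + y) + z
  join = solve-∀

∑ : (ℕ → ℕ) → ℕ → ℕ
∑ f zero    = 0
∑ f (suc h) = f (suc h) + ∑ f h

-- Each letter after the first of a non-crossing word opens a block one level
-- above the current height h, or repeats the open letter at one of the levels
-- 1, …, h.
continuations : ℕ → ℕ → ℕ
continuations zero    h = 1
continuations (suc k) h = ∑ (continuations k) (suc h)

-- Ballot numbers C(2k+h, k) - C(2k+h, k-1), with the subtraction moved across. Raising `h` by one
-- adds the single term `continuations k (2 + h)` to the sum, so Pascal's rule gives the step in
-- `h`. At `h = 0`, the Catalan case, the symmetry of row `2k + 1` starts the induction.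
continuations-closed : ∀ k h →
  continuations k h + (2 * k + h) C⁻ k ≡ (2 * k + h) C k
continuations-closed zero h = refl
continuations-closed (suc k) zero = begin
  (continuations k 1 + 0) + (2 * suc k + 0) C k
    ≡⟨ cong₂ (λ x n → x + n C k) (+-identityʳ _) (index k) ⟩
  continuations k 1 + suc n C k
    ≡⟨ cong (continuations k 1 +_) (trans (pascal n k) (+-comm (n C k) _)) ⟩
  continuations k 1 + (n C⁻ k + n C k)
    ≡⟨ sym (+-assoc (continuations k 1) _ _) ⟩
  continuations k 1 + n C⁻ k + n C k
    ≡⟨ cong (_+ n C k) (continuations-closed k 1) ⟩
  n C k + n C k
    ≡⟨ cong (_+ n C k) symmetric ⟩
  n C suc k + n C k
    ≡⟨ sym (pascal n (suc k)) ⟩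
  suc n C suc k
    ≡⟨ cong (_C suc k) (sym (index k)) ⟩
  (2 * suc k + 0) C suc k ∎
  where
  open ≡-Reasoning
  n = 2 * k + 1
  index : ∀ k → 2 * suc k + 0 ≡ suc (2 * k + 1)
  index = solve-∀
  halves : ∀ k → 2 * k + 1 ≡ suc k + k
  halves = solve-∀
  symmetric : n C k ≡ n C suc k
  symmetric = begin
    n C k       ≡⟨ nCk≡nC[n∸k] (≤-trans (m≤n+m k (suc k)) (≤-reflexive (sym (halves k)))) ⟩
    n C (n ∸ k) ≡⟨ cong (n C_) (trans (cong (_∸ k) (halves k)) (m+n∸n≡m (suc k) k)) ⟩
    n C suc k   ∎
continuations-closed (suc k) (suc h) = begin
  (continuations k (2 + h) + continuations (suc k) h) + (2 * suc k + suc h) C k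
    ≡⟨ cong (λ n → continuations k (2 + h) + continuations (suc k) h + n C k) (outer k h) ⟩
  (continuations k (2 + h) + continuations (suc k) h) + suc n C k
    ≡⟨ cong (continuations k (2 + h) + continuations (suc k) h +_) (pascal n k) ⟩
  (continuations k (2 + h) + continuations (suc k) h) + (n C k + n C⁻ k)
    ≡⟨ exchange (continuations k (2 + h)) (continuations (suc k) h) (n C k) (n C⁻ k) ⟩
  (continuations (suc k) h + n C k) + (continuations k (2 + h) + n C⁻ k)
    ≡⟨ cong₂ _+_ (continuations-closed (suc k) h)
         (subst (λ l → continuations k (2 + h) + l C⁻ k ≡ l C k) (inner k h)
           (continuations-closed k (2 + h))) ⟩
  n C suc k + n C k
    ≡⟨ sym (pascal n (suc k)) ⟩
  suc n C suc k
    ≡⟨ cong (_C suc k) (sym (outer k h)) ⟩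
  (2 * suc k + suc h) C suc k ∎
  where
  open ≡-Reasoning
  n = 2 * suc k + h
  outer : ∀ k h → 2 * suc k + suc h ≡ suc (2 * suc k + h)
  outer = solve-∀
  inner : ∀ k h → 2 * k + (2 + h) ≡ 2 * suc k + h
  inner = solve-∀
  exchange : ∀ a b c d → (a + b) + (c + d) ≡ (b + c) + (a + d)
  exchange = solve-∀

-- The total number of occurrences that start at the current letter, of height h,
-- or later, for a pattern with p ascents; k letters are left after an occurrence
-- that starts at the current letter.
occurrences : ℕ → ℕ → ℕ → ℕ
occurrences p zero    h = 1
occurrences p (suc k) h = continuations (suc k) (h + p) + ∑ (occurrences p k) (suc h)

-- Subtracting the recursion at consecutive heights leaves one term of each sum, so the induction is
-- on `k` and then on `h`. The height is `suc h`, so the factor `h` is the height minus one.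
occurrences-closed : ∀ p k h →
  occurrences p k (suc h) ≡ (2 * k + p + h + 2) C k + h * ((2 * k + p + h + 1) C⁻ k)
occurrences-closed p zero h =
  sym (cong suc (*-zeroʳ h))
occurrences-closed p (suc k) zero = begin
  continuations (suc k) (1 + p) + (occurrences p k 2 + (occurrences p k 1 + 0))
    ≡⟨ cong₂ (λ x y → continuations (suc k) (1 + p) + (x + (y + 0)))
         (occurrences-closed p k 1) (occurrences-closed p k 0) ⟩
  continuations (suc k) (1 + p) + (((2 * k + p + 1 + 2) C k + 1 * ((2 * k + p + 1 + 1) C⁻ k))
                                  + (((2 * k + p + 0 + 2) C k + 0) + 0))
    ≡⟨ cong (continuations (suc k) (1 + p) +_) (cong₂ _+_
         (cong₂ (λ i j → i C k + 1 * (j C⁻ k)) (index₁ k p) (index₂ k p))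
         (cong (λ i → i C k + 0 + 0) (index₃ k p))) ⟩
  continuations (suc k) (1 + p) + ((suc n C k + 1 * (n C⁻ k)) + ((n C k + 0) + 0))
    ≡⟨ regroup (continuations (suc k) (1 + p)) (suc n C k) (n C⁻ k) (n C k) ⟩
  (continuations (suc k) (1 + p) + suc n C k) + (n C k + n C⁻ k)
    ≡⟨ cong₂ _+_
         (subst (λ l → continuations (suc k) (1 + p) + l C k ≡ l C suc k) (index₄ k p)
           (continuations-closed (suc k) (1 + p)))
         (sym (pascal n k)) ⟩
  suc n C suc k + suc n C k
    ≡⟨ sym (pascal (suc n) (suc k)) ⟩
  suc (suc n) C suc k
    ≡⟨ sym (trans (+-identityʳ _) (cong (_C suc k) (index₅ k p))) ⟩
  (2 * suc k + p + 0 + 2) C suc k + 0 ∎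
  where
  open ≡-Reasoning
  n = 2 * k + p + 2
  index₁ : ∀ k p → 2 * k + p + 1 + 2 ≡ suc (2 * k + p + 2)
  index₁ = solve-∀
  index₂ : ∀ k p → 2 * k + p + 1 + 1 ≡ 2 * k + p + 2
  index₂ = solve-∀
  index₃ : ∀ k p → 2 * k + p + 0 + 2 ≡ 2 * k + p + 2
  index₃ = solve-∀
  index₄ : ∀ k p → 2 * suc k + (1 + p) ≡ suc (2 * k + p + 2)
  index₄ = solve-∀
  index₅ : ∀ k p → 2 * suc k + p + 0 + 2 ≡ suc (suc (2 * k + p + 2))
  index₅ = solve-∀
  regroup : ∀ s x y z → s + ((x + 1 * y) + ((z + 0) + 0)) ≡ (s + x) + (z + y)
  regroup = solve-∀
occurrences-closed p (suc k) (suc h) = begin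
  (continuations k (3 + h + p) + continuations (suc k) (1 + h + p))
    + (occurrences p k (3 + h) + ∑ (occurrences p k) (2 + h))
    ≡⟨ regroup₁ (continuations k (3 + h + p)) (continuations (suc k) (1 + h + p))
         (occurrences p k (3 + h)) (∑ (occurrences p k) (2 + h)) ⟩
  continuations k (3 + h + p) + occurrences p (suc k) (suc h) + occurrences p k (3 + h)
    ≡⟨ cong₂ (λ x y → continuations k (3 + h + p) + x + y)
         (occurrences-closed p (suc k) h) (occurrences-closed p k (2 + h)) ⟩
  continuations k (3 + h + p)
    + ((2 * suc k + p + h + 2) C suc k + h * ((2 * suc k + p + h + 1) C k))
    + ((2 * k + p + (2 + h) + 2) C k + (2 + h) * ((2 * k + p + (2 + h) + 1) C⁻ k))
    ≡⟨ cong₂ (λ x y → continuations k (3 + h + p) + x + y)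
         (cong₂ (λ i j → i C suc k + h * (j C k)) (index₁ k p h) (index₂ k p h))
         (cong₂ (λ i j → i C k + (2 + h) * (j C⁻ k)) (index₃ k p h) (index₄ k p h)) ⟩
  continuations k (3 + h + p) + (suc n C suc k + h * (n C k)) + (suc n C k + (2 + h) * (n C⁻ k))
    -- One of the `2 + h` copies of `n C⁻ k` is set aside to complete `continuations` to `n C k`;
    -- what remains collapses by Pascal's rule.
    ≡⟨ regroup₂ (continuations k (3 + h + p)) (suc n C suc k) h (n C k) (suc n C k) (n C⁻ k) ⟩
  (suc n C suc k + suc n C k) + (h * (n C k) + (1 + h) * (n C⁻ k) + (continuations k (3 + h + p) + n C⁻ k))
    ≡⟨ cong₂ (λ x y → x + (h * (n C k) + (1 + h) * (n C⁻ k) + y)) (sym (pascal (suc n) (suc k)))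
         (subst (λ l → continuations k (3 + h + p) + l C⁻ k ≡ l C k) (index₅ k p h)
           (continuations-closed k (3 + h + p))) ⟩
  suc (suc n) C suc k + (h * (n C k) + (1 + h) * (n C⁻ k) + n C k)
    ≡⟨ cong (suc (suc n) C suc k +_) (regroup₃ h (n C k) (n C⁻ k)) ⟩
  suc (suc n) C suc k + suc h * (n C k + n C⁻ k)
    ≡⟨ cong (λ x → suc (suc n) C suc k + suc h * x) (sym (pascal n k)) ⟩
  suc (suc n) C suc k + suc h * (suc n C k)
    ≡⟨ cong₂ (λ i j → i C suc k + suc h * (j C k)) (index₆ k p h) (index₇ k p h) ⟩
  (2 * suc k + p + suc h + 2) C suc k + suc h * ((2 * suc k + p + suc h + 1) C k) ∎
  where
  open ≡-Reasoning
  n = 2 * k + p + h + 3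
  index₁ : ∀ k p h → 2 * suc k + p + h + 2 ≡ suc (2 * k + p + h + 3)
  index₁ = solve-∀
  index₂ : ∀ k p h → 2 * suc k + p + h + 1 ≡ 2 * k + p + h + 3
  index₂ = solve-∀
  index₃ : ∀ k p h → 2 * k + p + (2 + h) + 2 ≡ suc (2 * k + p + h + 3)
  index₃ = solve-∀
  index₄ : ∀ k p h → 2 * k + p + (2 + h) + 1 ≡ 2 * k + p + h + 3
  index₄ = solve-∀
  index₅ : ∀ k p h → 2 * k + (3 + h + p) ≡ 2 * k + p + h + 3
  index₅ = solve-∀
  index₆ : ∀ k p h → suc (suc (2 * k + p + h + 3)) ≡ 2 * suc k + p + suc h + 2
  index₆ = solve-∀
  index₇ : ∀ k p h → suc (2 * k + p + h + 3) ≡ 2 * suc k + p + suc h + 1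
  index₇ = solve-∀
  regroup₁ : ∀ a b c d → (a + b) + (c + d) ≡ a + (b + d) + c
  regroup₁ = solve-∀
  regroup₂ : ∀ s x h y z w → s + (x + h * y) + (z + (2 + h) * w) ≡ (x + z) + (h * y + (1 + h) * w + (s + w))
  regroup₂ = solve-∀
  regroup₃ : ∀ h y w → h * y + (1 + h) * w + y ≡ suc h * (y + w)
  regroup₃ = solve-∀

-- Occurrences in the words generated by the stack

Decreasing : List ℕ → Set
Decreasing = AllPairs _>_

-- The words of length n that continue a non-crossing canonical form with
-- largest letter M, where s lists, from the top, the letters that can still
-- be repeated without creating a crossing.
extensions : ℕ → List ℕ → ℕ → List (List ℕ)
repeats    : ℕ → List ℕ → ℕ → List (List ℕ)
extensions zero    s M = [ [] ]
extensions (suc n) s M = map (suc M ∷_) (extensions n (suc M ∷ s) (suc M)) ++ repeats n s M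
repeats n []      M = []
repeats n (x ∷ s) M = map (x ∷_) (extensions n (x ∷ s) M) ++ repeats n s M

private
  variable
    A B : Set

sumOver : List A → (A → ℕ) → ℕ
sumOver xs f = sum (map f xs)

sumOver-++ : ∀ (xs ys : List A) f → sumOver (xs ++ ys) f ≡ sumOver xs f + sumOver ys f
sumOver-++ xs ys f = trans (cong sum (map-++ f xs ys)) (sum-++ (map f xs) (map f ys))

sumOver-map : ∀ (g : A → B) xs f → sumOver (map g xs) f ≡ sumOver xs (f ∘ g)
sumOver-map g xs f = cong sum (sym (map-∘ xs))

sumOver-cong : ∀ (xs : List A) {f g} → (∀ x → f x ≡ g x) → sumOver xs f ≡ sumOver xs g
sumOver-cong xs eq = cong sum (map-cong eq xs)

sumOver-+ : ∀ (xs : List A) f g → sumOver xs (λ x → f x + g x) ≡ sumOver xs f + sumOver xs g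
sumOver-+ []       f g = refl
sumOver-+ (x ∷ xs) f g = trans (cong (f x + g x +_) (sumOver-+ xs f g))
  (interchange +-commutativeSemigroup (f x) (g x) _ _)

sumOver-0 : ∀ (xs : List A) {f} → (∀ x → f x ≡ 0) → sumOver xs f ≡ 0
sumOver-0 []       eq = refl
sumOver-0 (x ∷ xs) eq = cong₂ _+_ (eq x) (sumOver-0 xs eq)

∑-0 : ∀ h → ∑ (λ _ → 0) h ≡ 0
∑-0 zero    = refl
∑-0 (suc h) = ∑-0 h

∑-cong : ∀ {f g} → (∀ h → f h ≡ g h) → ∀ h → ∑ f h ≡ ∑ g h
∑-cong eq zero    = refl
∑-cong eq (suc h) = cong₂ _+_ (eq (suc h)) (∑-cong eq h)

-- The stacks left by a repetition are the nonempty suffixes of `s`, one of each length, so a value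
-- that depends on the height alone sums to `∑ g`. The bound `b` on the letters is free, so that
-- callers can compare the repeated letter with whatever they need.
sumOver-repeats : ∀ {f} (g : ℕ → ℕ) n b s M → Decreasing (b ∷ s) →
  (∀ x s′ → Decreasing (b ∷ x ∷ s′) →
    sumOver (extensions n (x ∷ s′) M) (f ∘ (x ∷_)) ≡ g (length (x ∷ s′))) →
  sumOver (repeats n s M) f ≡ ∑ g (length s)
sumOver-repeats     g n b []      M d H = refl
sumOver-repeats {f} g n b (x ∷ s) M d@((_ ∷ b>s) ∷ (_ ∷ d′)) H = begin
  sumOver (map (x ∷_) (extensions n (x ∷ s) M) ++ repeats n s M) f
    ≡⟨ sumOver-++ (map (x ∷_) (extensions n (x ∷ s) M)) _ f ⟩
  sumOver (map (x ∷_) (extensions n (x ∷ s) M)) f + sumOver (repeats n s M) f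
    ≡⟨ cong₂ _+_ (trans (sumOver-map (x ∷_) (extensions n (x ∷ s) M) f) (H x s d))
         (sumOver-repeats g n b s M (b>s ∷ d′) H) ⟩
  ∑ g (length (x ∷ s)) ∎
  where open ≡-Reasoning

sumOver-extensions : ∀ f n s M → sumOver (extensions (suc n) s M) f ≡
  sumOver (extensions n (suc M ∷ s) (suc M)) (f ∘ (suc M ∷_)) + sumOver (repeats n s M) f
sumOver-extensions f n s M = trans
  (sumOver-++ (map (suc M ∷_) (extensions n (suc M ∷ s) (suc M))) _ f)
  (cong (_+ sumOver (repeats n s M) f) (sumOver-map (suc M ∷_) (extensions n (suc M ∷ s) (suc M)) f))

push-decreasing : ∀ {M s} → Decreasing (suc M ∷ s) → Decreasing (suc (suc M) ∷ suc M ∷ s)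
push-decreasing d@(M>s ∷ _) = (n<1+n _ ∷ All.map m<n⇒m<1+n M>s) ∷ d

count-extensions : ∀ n s M → Decreasing (suc M ∷ s) →
  sumOver (extensions n s M) (λ _ → 1) ≡ continuations n (length s)
count-extensions zero    s M d = refl
count-extensions (suc n) s M d = trans (sumOver-extensions (λ _ → 1) n s M)
  (cong₂ _+_ (count-extensions n (suc M ∷ s) (suc M) (push-decreasing d))
    (sumOver-repeats (continuations n) n (suc M) s M d
      λ x s′ d′ → count-extensions n (x ∷ s′) M d′))

-- Climbs: ascents followed by repetitions of the top

Climb : ℕ → ℕ → ℕ → List ℕ → Set
Climb zero    zero    x w       = ⊤
Climb zero    (suc a) x []      = ⊥
Climb zero    (suc a) x (y ∷ w) = x ≡ y × Climb zero a y w
Climb (suc j) a       x []      = ⊥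
Climb (suc j) a       x (y ∷ w) = x < y × Climb j a y w

climb? : ∀ j a x w → Dec (Climb j a x w)
climb? zero    zero    x w       = yes tt
climb? zero    (suc a) x []      = no id
climb? zero    (suc a) x (y ∷ w) = (x ≟ y) ×-dec climb? zero a y w
climb? (suc j) a       x []      = no id
climb? (suc j) a       x (y ∷ w) = (x <? y) ×-dec climb? j a y w

indicator : {P : Set} → Dec P → ℕ
indicator p? = if does p? then 1 else 0

indicator-⇔ : {P Q : Set} → P ⇔ Q → (p? : Dec P) (q? : Dec Q) → indicator p? ≡ indicator q?
indicator-⇔ P⇔Q p? q? = cong (if_then 1 else 0) (does-⇔ P⇔Q p? q?)

indicator-no : {P : Set} → ¬ P → (p? : Dec P) → indicator p? ≡ 0
indicator-no ¬p p? = cong (if_then 1 else 0) (dec-false p? ¬p)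

climbs : ℕ → ℕ → ℕ → ℕ → ℕ
climbs zero    zero    n       h = continuations n h
climbs zero    (suc a) zero    h = 0
climbs zero    (suc a) (suc n) h = climbs zero a n h
climbs (suc j) a       zero    h = 0
climbs (suc j) a       (suc n) h = climbs j a n (suc h)

-- Each required comparison leaves one choice of letter. An equality rules out the push, which
-- exceeds `x`, and the deeper letters, which are below `x`; an ascent rules out every repetition.
count-climbs : ∀ j a n x s M → Decreasing (suc M ∷ x ∷ s) →
  sumOver (extensions n (x ∷ s) M) (λ w → indicator (climb? j a x w)) ≡ climbs j a n (suc (length s))
count-climbs zero    zero    n       x s M d = count-extensions n (x ∷ s) M d
count-climbs zero    (suc a) zero    x s M d = refl
count-climbs zero    (suc a) (suc n) x s M d@((M>x ∷ _) ∷ x∷s↘@(x>s ∷ s↘)) = begin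
  sumOver (extensions (suc n) (x ∷ s) M) f
    ≡⟨ sumOver-extensions f n (x ∷ s) M ⟩
  sumOver (extensions n (suc M ∷ x ∷ s) (suc M)) (f ∘ (suc M ∷_)) + sumOver (repeats n (x ∷ s) M) f
    ≡⟨ cong₂ _+_
         (sumOver-0 (extensions n (suc M ∷ x ∷ s) (suc M))
           λ w → indicator-no (λ (eq , _) → <⇒≢ M>x eq) (climb? zero (suc a) x (suc M ∷ w)))
         (sumOver-++ (map (x ∷_) (extensions n (x ∷ s) M)) _ f) ⟩
  sumOver (map (x ∷_) (extensions n (x ∷ s) M)) f + sumOver (repeats n s M) f
    ≡⟨ cong₂ _+_
         (trans (sumOver-map (x ∷_) (extensions n (x ∷ s) M) f)
           (sumOver-cong (extensions n (x ∷ s) M)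
             λ w → indicator-⇔ (mk⇔ proj₂ (refl ,_)) (climb? zero (suc a) x (x ∷ w)) (climb? zero a x w)))
         (trans (sumOver-repeats (λ _ → 0) n x s M x∷s↘
           (λ { y s′ ((x>y ∷ _) ∷ _) → sumOver-0 (extensions n (y ∷ s′) M)
             λ w → indicator-no (λ (eq , _) → <⇒≢ x>y (sym eq)) (climb? zero (suc a) x (y ∷ w)) }))
           (∑-0 (length s))) ⟩
  sumOver (extensions n (x ∷ s) M) (λ w → indicator (climb? zero a x w)) + 0
    ≡⟨ +-identityʳ _ ⟩
  sumOver (extensions n (x ∷ s) M) (λ w → indicator (climb? zero a x w))
    ≡⟨ count-climbs zero a n x s M d ⟩
  climbs zero a n (suc (length s)) ∎
  where
  open ≡-Reasoning
  f = λ w → indicator (climb? zero (suc a) x w)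
count-climbs (suc j) a       zero    x s M d = refl
count-climbs (suc j) a       (suc n) x s M d@((M>x ∷ _) ∷ x∷s↘@(x>s ∷ s↘)) = begin
  sumOver (extensions (suc n) (x ∷ s) M) f
    ≡⟨ sumOver-extensions f n (x ∷ s) M ⟩
  sumOver (extensions n (suc M ∷ x ∷ s) (suc M)) (f ∘ (suc M ∷_)) + sumOver (repeats n (x ∷ s) M) f
    ≡⟨ cong₂ _+_
         (sumOver-cong (extensions n (suc M ∷ x ∷ s) (suc M))
           λ w → indicator-⇔ (mk⇔ proj₂ (M>x ,_)) (climb? (suc j) a x (suc M ∷ w)) (climb? j a (suc M) w))
         -- The bound is `suc x` because the top `x` itself must be covered: it cannot continue an
         -- ascent either.
         (trans (sumOver-repeats (λ _ → 0) n (suc x) (x ∷ s) M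
             ((n<1+n x ∷ All.map m<n⇒m<1+n x>s) ∷ x∷s↘)
           (λ { y s′ ((y≤x ∷ _) ∷ _) → sumOver-0 (extensions n (y ∷ s′) M)
             λ w → indicator-no (λ (x<y , _) → <-irrefl refl (<-≤-trans x<y (s≤s⁻¹ y≤x)))
               (climb? (suc j) a x (y ∷ w)) }))
           (∑-0 (length (x ∷ s)))) ⟩
  sumOver (extensions n (suc M ∷ x ∷ s) (suc M)) (λ w → indicator (climb? j a (suc M) w)) + 0
    ≡⟨ +-identityʳ _ ⟩
  sumOver (extensions n (suc M ∷ x ∷ s) (suc M)) (λ w → indicator (climb? j a (suc M) w))
    ≡⟨ count-climbs j a n (suc M) (x ∷ s) (suc M) (push-decreasing d) ⟩
  climbs j a n (suc (suc (length s))) ∎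
  where
  open ≡-Reasoning
  f = λ w → indicator (climb? (suc j) a x w)

-- Order isomorphism reduced to comparisons of neighbours

slope : ℕ → ℕ → ℕ → List ℕ
slope zero    zero    b = []
slope zero    (suc a) b = b ∷ slope zero a b
slope (suc j) a       b = suc b ∷ slope j a (suc b)

-- Fixes the parameters of a climb: `slope` counts the ascents and the repetitions after the first
-- letter, each one less than the corresponding parameter of the pattern.
risePlateau≡slope : ∀ m a → risePlateau (suc m) (suc a) ≡ 1 ∷ slope m a 1
risePlateau≡slope m a = go m 0 id (λ _ → refl)
  where
  plateau : ∀ a b → replicate (suc a) b ≡ b ∷ slope zero a b
  plateau zero    b = refl
  plateau (suc a) b = cong (b ∷_) (plateau a b)

  -- Unfolding `upTo` changes the function that is tabulated, so the induction allows any `f` that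
  -- agrees with `b +_`.
  go : ∀ j b (f : ℕ → ℕ) → (∀ i → f i ≡ b + i) →
    map suc (applyUpTo f j) ++ replicate (suc a) (suc (b + j)) ≡ suc b ∷ slope j a (suc b)
  go zero    b f eq = trans (cong (λ x → replicate (suc a) (suc x)) (+-identityʳ b)) (plateau a (suc b))
  go (suc j) b f eq = cong₂ _∷_ (cong suc (trans (eq 0) (+-identityʳ b)))
    (trans (cong (λ x → map suc (applyUpTo (f ∘ suc) j) ++ replicate (suc a) (suc x)) (+-suc b j))
      (go j (suc b) (f ∘ suc) (λ i → trans (eq (suc i)) (+-suc b i))))

window : ℕ → ℕ → ℕ → List ℕ → List ℕ
window j a b w = take (length (slope j a b)) w

climb-length : ∀ j a b x w → Climb j a x w → length (window j a b w) ≡ length (slope j a b)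
climb-length zero    zero    b x w       c       = refl
climb-length zero    (suc a) b x (y ∷ w) (_ , c) = cong suc (climb-length zero a b y w c)
climb-length (suc j) a       b x (y ∷ w) (_ , c) = cong suc (climb-length j a (suc b) y w c)

-- Neither sequence ever descends, so a later letter is above the first or equal to it, and which of
-- the two depends only on whether an ascent lies between. Applied at each starting point, this
-- yields all pairs of positions.
climb-head : ∀ j a b x w (c : Climb j a x w) (eq : length (window j a b w) ≡ length (slope j a b)) →
  ∀ q → (x < lookup (window j a b w) q × b < lookup (slope j a b) (cast eq q))
      ⊎ (x ≡ lookup (window j a b w) q × b ≡ lookup (slope j a b) (cast eq q))
climb-head zero    (suc a) b x (y ∷ w) (refl , c) eq Fin.zero    = inj₂ (refl , refl)
climb-head zero    (suc a) b x (y ∷ w) (refl , c) eq (Fin.suc q) =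
  climb-head zero a b y w c (cong pred eq) q
climb-head (suc j) a       b x (y ∷ w) (x<y , c)  eq Fin.zero    = inj₁ (x<y , n<1+n b)
climb-head (suc j) a       b x (y ∷ w) (x<y , c)  eq (Fin.suc q)
  with climb-head j a (suc b) y w c (cong pred eq) q
... | inj₁ (y< , b<) = inj₁ (<-trans x<y y< , <-trans (n<1+n b) b<)
... | inj₂ (y≡ , b≡) = inj₁ (<-≤-trans x<y (≤-reflexive y≡) , <-≤-trans (n<1+n b) (≤-reflexive b≡))

Agree : ℕ → ℕ → ℕ → ℕ → Set
Agree x y x′ y′ = (x < y ⇔ x′ < y′) × (x ≡ y ⇔ x′ ≡ y′)

agree-up : ∀ {x y x′ y′} → (x < y × x′ < y′) ⊎ (x ≡ y × x′ ≡ y′) → Agree x y x′ y′ × Agree y x y′ x′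
agree-up (inj₁ (l , l′)) =
  (mk⇔ (λ _ → l′) (λ _ → l) , mk⇔ (λ e → contradiction e (<⇒≢ l)) (λ e → contradiction e (<⇒≢ l′))) ,
  (mk⇔ (λ g → contradiction g (<-asym l)) (λ g → contradiction g (<-asym l′)) ,
   mk⇔ (λ e → contradiction (sym e) (<⇒≢ l)) (λ e → contradiction (sym e) (<⇒≢ l′)))
agree-up (inj₂ (refl , refl)) = same , same
  where
  same : ∀ {x y} → Agree x x y y
  same = mk⇔ (λ l → contradiction l (<-irrefl refl)) (λ l → contradiction l (<-irrefl refl)) ,
         mk⇔ (λ _ → refl) (λ _ → refl)

climb⇒agree : ∀ j a b x w → Climb j a x w →
  (eq : length (x ∷ window j a b w) ≡ length (b ∷ slope j a b)) → ∀ p q →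
  Agree (lookup (x ∷ window j a b w) p) (lookup (x ∷ window j a b w) q)
        (lookup (b ∷ slope j a b) (cast eq p)) (lookup (b ∷ slope j a b) (cast eq q))
climb⇒agree j a b x w c eq Fin.zero Fin.zero = proj₁ (agree-up (inj₂ (refl , refl)))
climb⇒agree j a b x w c eq Fin.zero (Fin.suc q) = proj₁ (agree-up (climb-head j a b x w c (cong pred eq) q))
climb⇒agree j a b x w c eq (Fin.suc p) Fin.zero = proj₂ (agree-up (climb-head j a b x w c (cong pred eq) p))
climb⇒agree zero    (suc a) b x (y ∷ w) (_ , c) eq (Fin.suc p) (Fin.suc q) =
  climb⇒agree zero a b y w c (cong pred eq) p q
climb⇒agree (suc j) a       b x (y ∷ w) (_ , c) eq (Fin.suc p) (Fin.suc q) =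
  climb⇒agree j a (suc b) y w c (cong pred eq) p q

orderIsomorphic-tail : ∀ {x y u v} → OrderIsomorphic (x ∷ u) (y ∷ v) → OrderIsomorphic u v
orderIsomorphic-tail (eq , f) = cong pred eq , λ p q → f (Fin.suc p) (Fin.suc q)

orderIsomorphic⇒climb : ∀ j a b x w →
  OrderIsomorphic (x ∷ window j a b w) (b ∷ slope j a b) → Climb j a x w
orderIsomorphic⇒climb zero    zero    b x w       o        = tt
orderIsomorphic⇒climb zero    (suc a) b x []      (() , _)
orderIsomorphic⇒climb zero    (suc a) b x (y ∷ w) o@(_ , f) =
  Equivalence.from (proj₂ (f Fin.zero (Fin.suc Fin.zero))) refl ,
  orderIsomorphic⇒climb zero a b y w (orderIsomorphic-tail o)
orderIsomorphic⇒climb (suc j) a       b x []      (() , _)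
orderIsomorphic⇒climb (suc j) a       b x (y ∷ w) o@(_ , f) =
  Equivalence.from (proj₁ (f Fin.zero (Fin.suc Fin.zero))) (n<1+n b) ,
  orderIsomorphic⇒climb j a (suc b) y w (orderIsomorphic-tail o)

climb⇔orderIsomorphic : ∀ j a b x w →
  OrderIsomorphic (x ∷ window j a b w) (b ∷ slope j a b) ⇔ Climb j a x w
climb⇔orderIsomorphic j a b x w = mk⇔ (orderIsomorphic⇒climb j a b x w)
  λ c → let eq = cong suc (climb-length j a b x w c) in eq , climb⇒agree j a b x w c eq

length-filter-indicator : ∀ {P : Pred A _} (P? : Decidable P) xs →
  length (filter P? xs) ≡ sumOver xs (indicator ∘ P?)
length-filter-indicator P? []       = refl
length-filter-indicator P? (x ∷ xs) with does (P? x)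
... | true  = cong suc (length-filter-indicator P? xs)
... | false = length-filter-indicator P? xs

-- If the pattern fits, there is one more starting index and the others shift by one. If it does
-- not, both truncated differences are 0 and the first window is too short to match.
μ-∷ : ∀ c τ x σ →
  μ (c ∷ τ) (x ∷ σ) ≡ indicator (orderIsomorphic? (x ∷ take (length τ) σ) (c ∷ τ)) + μ (c ∷ τ) σ
μ-∷ c τ x σ with length τ ≤? length σ
... | yes τ≤σ = begin
  length (filter (occurs? (x ∷ σ)) (upTo (suc (length σ) ∸ length τ)))
    ≡⟨ cong (λ k → length (filter (occurs? (x ∷ σ)) (upTo k))) (∸-suc τ≤σ) ⟩
  length (filter (occurs? (x ∷ σ)) (upTo (suc k)))
    ≡⟨ length-filter-indicator (occurs? (x ∷ σ)) (upTo (suc k)) ⟩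
  indicator (occurs? (x ∷ σ) 0) + sumOver (applyUpTo suc k) (indicator ∘ occurs? (x ∷ σ))
    ≡⟨ cong (λ is → indicator (occurs? (x ∷ σ) 0) + sumOver is (indicator ∘ occurs? (x ∷ σ)))
         (sym (map-applyUpTo id suc k)) ⟩
  indicator (occurs? (x ∷ σ) 0) + sumOver (map suc (upTo k)) (indicator ∘ occurs? (x ∷ σ))
    ≡⟨ cong (indicator (occurs? (x ∷ σ) 0) +_) (trans
         (sumOver-map suc (upTo k) (indicator ∘ occurs? (x ∷ σ)))
         (sym (length-filter-indicator (occurs? σ) (upTo k)))) ⟩
  indicator (occurs? (x ∷ σ) 0) + length (filter (occurs? σ) (upTo k)) ∎
  where
  open ≡-Reasoning
  k = length σ ∸ length τ
  occurs? : ∀ σ → Decidable (λ i → OrderIsomorphic (take (suc (length τ)) (drop i σ)) (c ∷ τ))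
  occurs? σ i = orderIsomorphic? (take (suc (length τ)) (drop i σ)) (c ∷ τ)
  ∸-suc : ∀ {m n} → m ≤ n → suc n ∸ m ≡ suc (n ∸ m)
  ∸-suc = +-∸-assoc 1
... | no τ≰σ
  rewrite m≤n⇒m∸n≡0 (≰⇒> τ≰σ) | m≤n⇒m∸n≡0 (<⇒≤ (≰⇒> τ≰σ)) =
  sym (trans (+-identityʳ _) (indicator-no
    (λ (eq , _) → τ≰σ (≤-trans (≤-reflexive (trans (sym (suc-injective eq)) (length-take (length τ) σ)))
                        (m⊓n≤n (length τ) (length σ))))
    (orderIsomorphic? (x ∷ take (length τ) σ) (c ∷ τ))))

-- The quantity of `occurrences`, with `n` counting all letters after the current one, whether or
-- not an occurrence still fits.
windows : ℕ → ℕ → ℕ → ℕ → ℕ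
windows j a zero    h = climbs j a zero h
windows j a (suc n) h = climbs j a (suc n) h + ∑ (windows j a n) (suc h)

module _ (j a b : ℕ) where

  private
    τ : List ℕ
    τ = b ∷ slope j a b

  μ-climb : ∀ x w → μ τ (x ∷ w) ≡ indicator (climb? j a x w) + μ τ w
  μ-climb x w = trans (μ-∷ b (slope j a b) x w) (cong (_+ μ τ w) (indicator-⇔ (climb⇔orderIsomorphic j a b x w)
    (orderIsomorphic? (x ∷ window j a b w) τ) (climb? j a x w)))

  -- The current letter `x` is kept as the top of the stack, so the window starting at it is
  -- governed by a known height. In `sum-μ-tail` no letter is current yet, and the next one read
  -- becomes so.
  sum-μ : ∀ n x s M → Decreasing (suc M ∷ x ∷ s) →
    sumOver (extensions n (x ∷ s) M) (λ w → μ τ (x ∷ w)) ≡ windows j a n (suc (length s))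
  sum-μ-tail : ∀ n s M → Decreasing (suc M ∷ s) →
    sumOver (extensions (suc n) s M) (μ τ) ≡ ∑ (windows j a n) (suc (length s))
  sum-μ zero    x s M d = begin
    sumOver (extensions 0 (x ∷ s) M) (λ w → μ τ (x ∷ w)) ≡⟨ +-identityʳ _ ⟩
    μ τ (x ∷ [])                                         ≡⟨ μ-climb x [] ⟩
    indicator (climb? j a x []) + μ τ []                 ≡⟨ cong (indicator (climb? j a x []) +_) (μ[] (length (slope j a b))) ⟩
    indicator (climb? j a x []) + 0                      ≡⟨ count-climbs j a zero x s M d ⟩
    climbs j a zero (suc (length s))                     ∎
    where
    open ≡-Reasoning
    μ[] : ∀ k → length (filter (λ i → orderIsomorphic? (take (suc k) (drop i [])) τ) (upTo (0 ∸ k))) ≡ 0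
    μ[] zero    = refl
    μ[] (suc k) = refl
  sum-μ (suc n) x s M d = begin
    sumOver (extensions (suc n) (x ∷ s) M) (λ w → μ τ (x ∷ w))
      ≡⟨ sumOver-cong (extensions (suc n) (x ∷ s) M) (μ-climb x) ⟩
    sumOver (extensions (suc n) (x ∷ s) M) (λ w → indicator (climb? j a x w) + μ τ w)
      ≡⟨ sumOver-+ (extensions (suc n) (x ∷ s) M) _ _ ⟩
    sumOver (extensions (suc n) (x ∷ s) M) (λ w → indicator (climb? j a x w)) +
      sumOver (extensions (suc n) (x ∷ s) M) (μ τ)
      ≡⟨ cong₂ _+_ (count-climbs j a (suc n) x s M d) (sum-μ-tail n (x ∷ s) M d) ⟩
    windows j a (suc n) (suc (length s)) ∎
    where open ≡-Reasoning
  sum-μ-tail n s M d = trans (sumOver-extensions (μ τ) n s M)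
    (cong₂ _+_ (sum-μ n (suc M) s (suc M) (push-decreasing d))
      (sumOver-repeats (windows j a n) n (suc M) s M d λ x s′ d′ → sum-μ n x s′ M d′))

climbs-short : ∀ j a n h → n < j + a → climbs j a n h ≡ 0
climbs-short zero    (suc a) zero    h n<j+a = refl
climbs-short zero    (suc a) (suc n) h n<j+a = climbs-short zero a n h (s≤s⁻¹ n<j+a)
climbs-short (suc j) a       zero    h n<j+a = refl
climbs-short (suc j) a       (suc n) h n<j+a = climbs-short j a n (suc h) (s≤s⁻¹ n<j+a)

-- The point where the plateau disappears: `j` pushes raise the height to `h + j`, and the `a`
-- repetitions use up letters but leave it there.
climbs-long : ∀ j a k h → climbs j a (j + a + k) h ≡ continuations k (h + j)
climbs-long zero    zero    k h = cong (continuations k) (sym (+-identityʳ h))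
climbs-long zero    (suc a) k h = climbs-long zero a k h
climbs-long (suc j) a       k h = trans (climbs-long j a k (suc h)) (cong (continuations k) (sym (+-suc h j)))

windows-short : ∀ j a n h → n < j + a → windows j a n h ≡ 0
windows-short j a zero    h n<j+a = climbs-short j a zero h n<j+a
windows-short j a (suc n) h n<j+a = cong₂ _+_ (climbs-short j a (suc n) h n<j+a)
  (trans (∑-cong (λ h → windows-short j a n h (<⇒≤ n<j+a)) (suc h)) (∑-0 (suc h)))

-- The equation is a hypothesis so that `n` and `k` can descend together. Once `k` is 0, an
-- occurrence starting any later no longer fits.
windows-long : ∀ j a k n h → n ≡ j + a + k → windows j a n h ≡ occurrences j k h
windows-long j a zero zero h eq = trans (cong (λ n → climbs j a n h) eq) (climbs-long j a 0 h)
windows-long j a zero (suc n) h eq = cong₂ _+_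
  (trans (cong (λ n → climbs j a n h) eq) (climbs-long j a 0 h))
  (trans (∑-cong (λ h → windows-short j a n h (≤-reflexive (trans eq (+-identityʳ (j + a))))) (suc h)) (∑-0 (suc h)))
windows-long j a (suc k) zero h eq with trans eq (+-suc (j + a) k)
... | ()
windows-long j a (suc k) (suc n) h eq = cong₂ _+_
  (trans (cong (λ n → climbs j a n h) eq) (climbs-long j a (suc k) h))
  (∑-cong (λ h → windows-long j a k n h (suc-injective (trans eq (+-suc (j + a) k)))) (suc h))

sumOver-extensions-μ : ∀ j a k →
  sumOver (extensions (suc (j + a + k)) [] 0) (μ (1 ∷ slope j a 1)) ≡ (2 * k + j + 2) C k
sumOver-extensions-μ j a k = begin
  sumOver (extensions (suc (j + a + k)) [] 0) (μ (1 ∷ slope j a 1)) ≡⟨ sum-μ-tail j a 1 (j + a + k) [] 0 ([] ∷ []) ⟩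
  windows j a (j + a + k) 1 + 0                                     ≡⟨ +-identityʳ _ ⟩
  windows j a (j + a + k) 1                                         ≡⟨ windows-long j a k (j + a + k) 1 refl ⟩
  occurrences j k 1                                                 ≡⟨ occurrences-closed j k 0 ⟩
  (2 * k + j + 0 + 2) C k + 0                                       ≡⟨ +-identityʳ _ ⟩
  (2 * k + j + 0 + 2) C k                                           ≡⟨ cong (λ i → (i + 2) C k) (+-identityʳ (2 * k + j)) ⟩
  (2 * k + j + 2) C k                                               ∎
  where
  open ≡-Reasoning

-- The stack generates the non-crossing partitions

private
  variable
    k n M K x y b : ℕ
    s u : List ℕ

dropTo : x ∈ s → List ℕ
dropTo {s = s}     (here _)  = s
dropTo {s = _ ∷ _} (there i) = dropTo i

-- The rule behind `extensions` as a relation on a single word: the lists serve for counting, this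
-- form for induction along the word.
data Continues : List ℕ → ℕ → List ℕ → Set where
  []     : Continues s M []
  push   : Continues (suc M ∷ s) (suc M) u → Continues s M (suc M ∷ u)
  repeat : (i : x ∈ s) → Continues (dropTo i) M u → Continues s M (x ∷ u)

∈-dropTo⁻ : (i : x ∈ s) → y ∈ dropTo i → y ∈ s
∈-dropTo⁻ (here _)  j = j
∈-dropTo⁻ (there i) j = there (∈-dropTo⁻ i j)

dropTo-decreasing : Decreasing (b ∷ s) → (i : x ∈ s) → Decreasing (b ∷ dropTo i)
dropTo-decreasing d                        (here _)  = d
dropTo-decreasing ((_ ∷ b>s) ∷ (_ ∷ d)) (there i) = dropTo-decreasing (b>s ∷ d) i

dropTo-≤ : Decreasing s → (i : x ∈ s) → y ∈ dropTo i → y ≤ x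
dropTo-≤ (z>s ∷ d) (here refl) (here refl) = ≤-refl
dropTo-≤ (z>s ∷ d) (here refl) (there j)   = <⇒≤ (All.lookup z>s j)
dropTo-≤ (z>s ∷ d) (there i)   j           = dropTo-≤ d i j

∈-dropTo⁺ : Decreasing s → (i : x ∈ s) → y ∈ s → y ≤ x → y ∈ dropTo i
∈-dropTo⁺ d         (here _)  j         y≤x = j
∈-dropTo⁺ (z>s ∷ d) (there i) (here refl) y≤x = contradiction (All.lookup z>s i) (≤⇒≯ y≤x)
∈-dropTo⁺ (z>s ∷ d) (there i) (there j) y≤x = ∈-dropTo⁺ d i j y≤x

∈-repeats⁺ : ∀ n → (i : x ∈ s) → u ∈ extensions n (dropTo i) M → x ∷ u ∈ repeats n s M
∈-repeats⁺ n (here refl) u∈ = ∈-++⁺ˡ (∈-map⁺ _ u∈)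
∈-repeats⁺ {M = M} n (there {z} {s} i) u∈ =
  ∈-++⁺ʳ (map (z ∷_) (extensions n (z ∷ s) M)) (∈-repeats⁺ n i u∈)

∈-repeats⁻ : ∀ n s M → u ∈ repeats n s M →
  ∃₂ λ x u′ → ∃ λ (i : x ∈ s) → u ≡ x ∷ u′ × u′ ∈ extensions n (dropTo i) M
∈-repeats⁻ n (z ∷ s) M u∈ with ∈-++⁻ (map (z ∷_) (extensions n (z ∷ s) M)) u∈
... | inj₁ u∈map with ∈-map⁻ (z ∷_) u∈map
...   | u′ , u′∈ , eq = z , u′ , here refl , eq , u′∈
∈-repeats⁻ n (z ∷ s) M u∈ | inj₂ u∈repeats with ∈-repeats⁻ n s M u∈repeats
...   | x , u′ , i , eq , u′∈ = x , u′ , there i , eq , u′∈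

continues⇒∈ : Continues s M u → u ∈ extensions (length u) s M
continues⇒∈ []           = here refl
continues⇒∈ (push c)     = ∈-++⁺ˡ (∈-map⁺ _ (continues⇒∈ c))
continues⇒∈ {s} {M} {x ∷ u} (repeat i c) =
  ∈-++⁺ʳ (map (suc M ∷_) (extensions (length u) (suc M ∷ s) (suc M))) (∈-repeats⁺ (length u) i (continues⇒∈ c))

∈⇒continues : ∀ n s M → u ∈ extensions n s M → length u ≡ n × Continues s M u
∈⇒continues zero    s M (here refl) = refl , []
∈⇒continues (suc n) s M u∈ with ∈-++⁻ (map (suc M ∷_) (extensions n (suc M ∷ s) (suc M))) u∈
... | inj₁ u∈map with ∈-map⁻ (suc M ∷_) u∈map
...   | u′ , u′∈ , refl with ∈⇒continues n (suc M ∷ s) (suc M) u′∈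
...     | eq , c = cong suc eq , push c
∈⇒continues (suc n) s M u∈ | inj₂ u∈repeats with ∈-repeats⁻ n s M u∈repeats
...   | x , u′ , i , refl , u′∈ with ∈⇒continues n (dropTo i) M u′∈
...     | eq , c = cong suc eq , repeat i c

extensions-unique : ∀ n s M → Decreasing (suc M ∷ s) → Unique (extensions n s M)
repeats-unique    : ∀ n s M → Decreasing (suc M ∷ s) → Unique (repeats n s M)
extensions-unique zero    s M d = [] ∷ []
extensions-unique (suc n) s M d@(M>s ∷ _) = Unique.++⁺
  (Unique.map⁺ ∷-injectiveʳ (extensions-unique n (suc M ∷ s) (suc M) (push-decreasing d)))
  (repeats-unique n s M d)
  disjoint
  where
  disjoint : ∀ {u} → ¬ (u ∈ map (suc M ∷_) (extensions n (suc M ∷ s) (suc M)) × u ∈ repeats n s M)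
  disjoint (u∈map , u∈repeats) with ∈-map⁻ (suc M ∷_) u∈map | ∈-repeats⁻ n s M u∈repeats
  ... | _ , _ , refl | _ , _ , i , refl , _ = <-irrefl refl (All.lookup M>s i)
repeats-unique n []      M d = []
repeats-unique n (x ∷ s) M d@((_ ∷ M>s) ∷ (x>s ∷ d′)) = Unique.++⁺
  (Unique.map⁺ ∷-injectiveʳ (extensions-unique n (x ∷ s) M d))
  (repeats-unique n s M (M>s ∷ d′))
  disjoint
  where
  disjoint : ∀ {u} → ¬ (u ∈ map (x ∷_) (extensions n (x ∷ s) M) × u ∈ repeats n s M)
  disjoint (u∈map , u∈repeats) with ∈-map⁻ (x ∷_) u∈map | ∈-repeats⁻ n s M u∈repeats
  ... | _ , _ , refl | _ , _ , i , refl , _ = <-irrefl refl (All.lookup x>s i)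

-- Restricted M u K: the letters of u that exceed M are M + 1, …, K, and they
-- make their first appearances in this order.
data Restricted : ℕ → List ℕ → ℕ → Set where
  []  : Restricted M [] M
  new : Restricted (suc M) u K → Restricted M (suc M ∷ u) K
  old : x ≤ M → Restricted M u K → Restricted M (x ∷ u) K

-- `new` and `old` exclude each other, since `suc M` is not at most `M`. A word thus fixes its
-- number of blocks, which separates the parts of `NC` for different `k`.
restricted-deterministic : ∀ {K′} → Restricted M u K → Restricted M u K′ → K ≡ K′
restricted-deterministic []        []         = refl
restricted-deterministic (new r)   (new r′)   = restricted-deterministic r r′
restricted-deterministic (new r)   (old l r′) = contradiction l (<-irrefl refl)
restricted-deterministic (old l r) (new r′)   = contradiction l (<-irrefl refl)
restricted-deterministic (old l r) (old _ r′) = restricted-deterministic r r′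

restricted-≤ : Restricted M u K → M ≤ K
restricted-≤ []        = ≤-refl
restricted-≤ (new r)   = <⇒≤ (restricted-≤ r)
restricted-≤ (old _ r) = restricted-≤ r

restricted-letters : Restricted M u K → x ∈ u → x ≤ K
restricted-letters (new r)   (here refl) = restricted-≤ r
restricted-letters (new r)   (there i)   = restricted-letters r i
restricted-letters (old l r) (here refl) = ≤-trans l (restricted-≤ r)
restricted-letters (old l r) (there i)   = restricted-letters r i

restricted-length : Restricted M u K → K ≤ length u + M
restricted-length []        = ≤-refl
restricted-length {M} {u = _ ∷ u} (new r) =
  ≤-trans (restricted-length r) (≤-reflexive (+-suc (length u) M))
restricted-length (old l r) = m≤n⇒m≤1+n (restricted-length r)

continues⇒restricted : Decreasing (suc M ∷ s) → Continues s M u → ∃ (Restricted M u)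
continues⇒restricted d []       = _ , []
continues⇒restricted d (push c) with continues⇒restricted (push-decreasing d) c
... | K , r = K , new r
continues⇒restricted d@(M>s ∷ _) (repeat i c) with continues⇒restricted (dropTo-decreasing d i) c
... | K , r = K , old (s≤s⁻¹ (All.lookup M>s i)) r

-- Popped letters never return, because repetitions only shorten the stack and pushes only add
-- letters above `M`.
continues-old : Decreasing (suc M ∷ s) → Continues s M u → x ∈ u → x ≤ M → x ∈ s
continues-old d (push c)     (here refl) x≤M = contradiction x≤M (<-irrefl refl)
continues-old d (push c)     (there j)   x≤M
  with continues-old (push-decreasing d) c j (m≤n⇒m≤1+n x≤M)
... | here refl = contradiction x≤M (<-irrefl refl)
... | there x∈s = x∈s
continues-old d (repeat i c) (here refl) x≤M = i
continues-old d (repeat i c) (there j)   x≤M = ∈-dropTo⁻ i (continues-old (dropTo-decreasing d i) c j x≤M)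

module _ {a b : ℕ} (a<b : a < b) where

  -- Repeating `a` pops every larger letter, so a `b` that has already been opened cannot follow;
  -- and `a` cannot be new, being below `b`.
  continues-avoids-ab : Decreasing (suc M ∷ s) → Continues s M u → b ≤ M →
    ¬ (a ∷ b ∷ [] ⊆ u)
  continues-avoids-ab d (push c) b≤M (_ ∷ʳ τ) =
    continues-avoids-ab (push-decreasing d) c (m≤n⇒m≤1+n b≤M) τ
  continues-avoids-ab d (push c) b≤M (refl ∷ τ) = <-irrefl refl (<-trans a<b (s≤s b≤M))
  continues-avoids-ab d (repeat i c) b≤M (_ ∷ʳ τ) =
    continues-avoids-ab (dropTo-decreasing d i) c b≤M τ
  continues-avoids-ab d@(_ ∷ s↘) (repeat i c) b≤M (refl ∷ τ) =
    <⇒≱ a<b (dropTo-≤ s↘ i (continues-old (dropTo-decreasing d i) c (to∈ τ) b≤M))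

  continues-avoids-bab : Decreasing (suc M ∷ s) → Continues s M u → a ≤ M →
    ¬ (b ∷ a ∷ b ∷ [] ⊆ u)
  continues-avoids-bab d (push c) a≤M (_ ∷ʳ τ) =
    continues-avoids-bab (push-decreasing d) c (m≤n⇒m≤1+n a≤M) τ
  continues-avoids-bab d (push c) a≤M (refl ∷ τ) =
    continues-avoids-ab (push-decreasing d) c ≤-refl τ
  continues-avoids-bab d (repeat i c) a≤M (_ ∷ʳ τ) =
    continues-avoids-bab (dropTo-decreasing d i) c a≤M τ
  continues-avoids-bab d@(M>s ∷ _) (repeat i c) a≤M (refl ∷ τ) =
    continues-avoids-ab (dropTo-decreasing d i) c (s≤s⁻¹ (All.lookup M>s i)) τ

  continues-avoids-abab : Decreasing (suc M ∷ s) → Continues s M u →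
    ¬ (a ∷ b ∷ a ∷ b ∷ [] ⊆ u)
  continues-avoids-abab d (push c) (_ ∷ʳ τ) = continues-avoids-abab (push-decreasing d) c τ
  continues-avoids-abab d (push c) (refl ∷ τ) =
    continues-avoids-bab (push-decreasing d) c ≤-refl τ
  continues-avoids-abab d (repeat i c) (_ ∷ʳ τ) = continues-avoids-abab (dropTo-decreasing d i) c τ
  continues-avoids-abab d@(M>s ∷ _) (repeat i c) (refl ∷ τ) =
    continues-avoids-bab (dropTo-decreasing d i) c (s≤s⁻¹ (All.lookup M>s i)) τ

-- With the word read so far in front of u, no crossing ends inside u: the
-- second, third and fourth conditions concern the crossings that have two,
-- one and none of their four letters in front of u.
record Compatible (s : List ℕ) (M : ℕ) (u : List ℕ) : Set where
  field
    reuses      : ∀ {x} → x ∈ u → x ≤ M → x ∈ s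
    avoids-ab   : ∀ {a b} → a < b → b ≤ M → ¬ (a ∷ b ∷ [] ⊆ u)
    avoids-bab  : ∀ {a b} → a < b → a ≤ M → ¬ (b ∷ a ∷ b ∷ [] ⊆ u)
    avoids-abab : ∀ {a b} → a < b → ¬ (a ∷ b ∷ a ∷ b ∷ [] ⊆ u)

open Compatible

-- Moving the next letter into the prefix turns a pattern of `u` beginning with that letter into the
-- next shorter pattern, so the conditions for the rest of the word come from those for `u`.
compatible⇒continues : Decreasing (suc M ∷ s) → Restricted M u K → Compatible s M u → Continues s M u
compatible⇒continues d [] D = []
compatible⇒continues {M} {s} {_ ∷ u} d (new r) D = push (compatible⇒continues (push-decreasing d) r D′)
  where
  D′ : Compatible (suc M ∷ s) (suc M) u
  D′ .reuses i x≤ with m≤n⇒m<n∨m≡n x≤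
  ... | inj₁ x<  = there (reuses D (there i) (s≤s⁻¹ x<))
  ... | inj₂ x≡  = here x≡
  D′ .avoids-ab a<b b≤ τ with m≤n⇒m<n∨m≡n b≤
  ... | inj₁ b<   = avoids-ab D a<b (s≤s⁻¹ b<) (_ ∷ʳ τ)
  -- Here `b` is the letter just pushed, and putting it back in front completes `b a b`.
  ... | inj₂ refl = avoids-bab D a<b (s≤s⁻¹ a<b) (refl ∷ τ)
  D′ .avoids-bab a<b a≤ τ with m≤n⇒m<n∨m≡n a≤
  ... | inj₁ a<   = avoids-bab D a<b (s≤s⁻¹ a<) (_ ∷ʳ τ)
  ... | inj₂ refl = avoids-abab D a<b (refl ∷ τ)
  D′ .avoids-abab a<b τ = avoids-abab D a<b (_ ∷ʳ τ)
compatible⇒continues {M} {s} {x ∷ u} d@(_ ∷ s↘) (old x≤M r) D =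
  repeat i (compatible⇒continues (dropTo-decreasing d i) r D′)
  where
  i = reuses D (here refl) x≤M
  D′ : Compatible (dropTo i) M u
  D′ .reuses {y} j y≤M with y ≤? x
  ... | yes y≤x = ∈-dropTo⁺ s↘ i (reuses D (there j) y≤M) y≤x
  -- A letter `y` popped by `x` that returned later would form the forbidden pair `x y`.
  ... | no  y≰x = contradiction (refl ∷ from∈ j) (avoids-ab D (≰⇒> y≰x) y≤M)
  D′ .avoids-ab   a<b b≤M τ = avoids-ab   D a<b b≤M (_ ∷ʳ τ)
  D′ .avoids-bab  a<b a≤M τ = avoids-bab  D a<b a≤M (_ ∷ʳ τ)
  D′ .avoids-abab a<b     τ = avoids-abab D a<b     (_ ∷ʳ τ)

-- Canonical forms and crossings in terms of positions

letter : Vec (Fin k) n → Fin n → ℕ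
letter w i = suc (toℕ (Vec.lookup w i))

letter-∈ : ∀ (w : Vec (Fin k) n) i → letter w i ∈ letters w
letter-∈ (x ∷ w) Fin.zero    = here refl
letter-∈ (x ∷ w) (Fin.suc i) = there (letter-∈ w i)

letters-positive : ∀ (w : Vec (Fin k) n) → ¬ (0 ∈ letters w)
letters-positive (x ∷ w) (there i) = letters-positive w i

length-letters : ∀ (w : Vec (Fin k) n) → length (letters w) ≡ n
length-letters []      = refl
length-letters (x ∷ w) = cong suc (length-letters w)

letters-injective : ∀ (v w : Vec (Fin k) n) → letters v ≡ letters w → v ≡ w
letters-injective []      []      eq = refl
letters-injective (x ∷ v) (y ∷ w) eq = cong₂ _∷_
  (toℕ-injective (suc-injective (∷-injectiveˡ eq))) (letters-injective v w (∷-injectiveʳ eq))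

letters-surjective : ∀ k u → All (λ x → 0 < x × x ≤ k) u → ∃ λ (w : Vec (Fin k) (length u)) → letters w ≡ u
letters-surjective k []          []                = [] , refl
letters-surjective k (suc x ∷ u) ((_ , x<k) ∷ ps) with letters-surjective k u ps
... | w , eq = fromℕ< x<k ∷ w , cong₂ _∷_ (cong suc (toℕ-fromℕ< x<k)) eq

-- Restricted growth by positions, with the letters up to `M` counted as already seen. It carries
-- the order of the block minima, while `Attains` carries the nonemptiness of the blocks.
Precedes : ℕ → Vec (Fin k) n → Set
Precedes M w = ∀ i j → M < j → j < letter w i → ∃ λ i′ → i′ Fin.< i × letter w i′ ≡ j

Attains : ℕ → Vec (Fin k) n → Set
Attains {k} M w = ∀ j → M < j → j ≤ k → ∃ λ i → letter w i ≡ j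

precedes⇒restricted : ∀ (w : Vec (Fin k) n) → M ≤ k → Precedes M w → Attains M w → Restricted M (letters w) k
precedes⇒restricted {M = M} [] M≤k P A with m≤n⇒m<n∨m≡n M≤k
... | inj₂ refl = []
... | inj₁ M<k with A (suc M) ≤-refl M<k
...   | () , _
precedes⇒restricted {M = M} (x ∷ w) M≤k P A with <-cmp (suc (toℕ x)) (suc M)
... | tri< x≤M _ _ = old (s≤s⁻¹ x≤M) (precedes⇒restricted w M≤k P′ A′)
  where
  P′ : Precedes M w
  P′ i j M<j j< with P (Fin.suc i) j M<j j<
  ... | Fin.zero   , _   , refl = contradiction M<j (≤⇒≯ (s≤s⁻¹ x≤M))
  ... | Fin.suc i′ , i′< , eq   = i′ , s≤s⁻¹ i′< , eq
  A′ : Attains M w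
  A′ j M<j j≤ with A j M<j j≤
  ... | Fin.zero   , refl = contradiction M<j (≤⇒≯ (s≤s⁻¹ x≤M))
  ... | Fin.suc i′ , eq   = i′ , eq
... | tri≈ _ refl _ = new (precedes⇒restricted w (toℕ<n x) P′ A′)
  where
  P′ : Precedes (suc (toℕ x)) w
  P′ i j M<j j< with P (Fin.suc i) j (<-trans (n<1+n _) M<j) j<
  ... | Fin.zero   , _   , refl = contradiction M<j (<-irrefl refl)
  ... | Fin.suc i′ , i′< , eq   = i′ , s≤s⁻¹ i′< , eq
  A′ : Attains (suc (toℕ x)) w
  A′ j M<j j≤ with A j (<-trans (n<1+n _) M<j) j≤
  ... | Fin.zero   , refl = contradiction M<j (<-irrefl refl)
  ... | Fin.suc i′ , eq   = i′ , eq
... | tri> _ _ x>M with P Fin.zero (suc M) ≤-refl x>M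
...   | _ , () , _

restricted⇒precedes : ∀ (w : Vec (Fin k) n) → Restricted M (letters w) K → Precedes M w
restricted⇒precedes (x ∷ w) (new r)     Fin.zero    j M<j j< = contradiction (≤-trans j< M<j) (<-irrefl refl)
restricted⇒precedes (x ∷ w) (old x≤M r) Fin.zero    j M<j j< = contradiction (<-trans M<j j<) (≤⇒≯ x≤M)
restricted⇒precedes (x ∷ w) (new r)     (Fin.suc i) j M<j j< with m≤n⇒m<n∨m≡n M<j
... | inj₂ eq = Fin.zero , s≤s z≤n , eq
... | inj₁ x<j with restricted⇒precedes w r i j x<j j<
...   | i′ , i′< , eq = Fin.suc i′ , s≤s i′< , eq
restricted⇒precedes (x ∷ w) (old x≤M r) (Fin.suc i) j M<j j< with restricted⇒precedes w r i j M<j j<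
...   | i′ , i′< , eq = Fin.suc i′ , s≤s i′< , eq

restricted⇒attains : ∀ (w : Vec (Fin k) n) → Restricted M (letters w) k → Attains M w
restricted⇒attains []      []        j M<j j≤ = contradiction j≤ (<⇒≱ M<j)
restricted⇒attains (x ∷ w) (new r)   j M<j j≤ with m≤n⇒m<n∨m≡n M<j
... | inj₂ eq = Fin.zero , eq
... | inj₁ x<j with restricted⇒attains w r j x<j j≤
...   | i , eq = Fin.suc i , eq
restricted⇒attains (x ∷ w) (old _ r) j M<j j≤ with restricted⇒attains w r j M<j j≤
...   | i , eq = Fin.suc i , eq

canonical⇒restricted : ∀ (w : Vec (Fin k) n) → IsCanonicalForm w → Restricted 0 (letters w) k
canonical⇒restricted {k} w (B , P , ordered , canonical) = precedes⇒restricted w z≤n before attains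
  where
  open IsSetPartition P
  block : ∀ {i j} → i ∈ˢ B j → Vec.lookup w i ≡ j
  block {i} {j} i∈ = disjoint i _ j (canonical i) i∈
  before : Precedes 0 w
  before i (suc j) _ (s≤s j<l) with fromℕ< (<-trans j<l (toℕ<n (Vec.lookup w i))) in eq
  ... | f with toℕ-fromℕ< (<-trans j<l (toℕ<n (Vec.lookup w i)))
  ...   | eq′ rewrite eq with ordered f (Vec.lookup w i) (subst (_< _) (sym eq′) j<l)
  -- The minimum of block `f` is the required position: it precedes the minimum of the block of `i`,
  -- which is at most `i`.
  ...     | i₁ , i₂ , (i₁∈ , _) , (_ , least) , i₁<i₂ =
    i₁ , <-≤-trans i₁<i₂ (least i (canonical i)) , cong suc (trans (cong toℕ (block i₁∈)) eq′)
  attains : Attains 0 w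
  attains (suc j) _ j<k with nonempty (fromℕ< j<k)
  ... | i , i∈ = i , cong suc (trans (cong toℕ (block i∈)) (toℕ-fromℕ< j<k))

minimum-exists : ∀ (p : Subset n) → Nonempty p → ∃ (IsMin p)
minimum-exists (inside ∷ p) _ = Fin.zero , Vec.here , λ _ _ → z≤n
minimum-exists (outside ∷ p) (Fin.suc i , Vec.there i∈) with minimum-exists p (i , i∈)
... | m , m∈ , least = Fin.suc m , Vec.there m∈ , λ { (Fin.suc i′) (Vec.there i′∈) → s≤s (least i′ i′∈) }

restricted⇒canonical : ∀ (w : Vec (Fin k) n) → Restricted 0 (letters w) k → IsCanonicalForm w
restricted⇒canonical w r = blocks w , record
  { nonempty = inhabited
  ; disjoint = λ i j j′ i∈ i∈′ → trans (sym (∈-blocks⁻ w i∈)) (∈-blocks⁻ w i∈′)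
  ; cover    = λ i → Vec.lookup w i , ∈-blocks⁺ w refl
  } , ordered , λ i → ∈-blocks⁺ w refl
  where
  ∈-block : ∀ {i j} → letter w i ≡ suc (toℕ j) → i ∈ˢ blocks w j
  ∈-block eq = ∈-blocks⁺ w (toℕ-injective (suc-injective eq))
  inhabited : ∀ j → Nonempty (blocks w j)
  inhabited j with restricted⇒attains w r (suc (toℕ j)) (s≤s z≤n) (toℕ<n j)
  ... | i , eq = i , ∈-block eq
  ordered : MinOrdered (blocks w)
  ordered j j′ j<j′ with minimum-exists _ (inhabited j) | minimum-exists _ (inhabited j′)
  ... | m , m∈ , least | m′ , m′∈ , least′
    with restricted⇒precedes w r m′ (suc (toℕ j)) (s≤s z≤n)
           (subst (λ l → suc (toℕ j) < suc (toℕ l)) (sym (∈-blocks⁻ w m′∈)) (s≤s j<j′))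
  ...   | i , i<m′ , eq = m , m′ , (m∈ , least) , (m′∈ , least′) , ≤-<-trans (least i (∈-block eq)) i<m′

shift : ∀ (ps : List (Fin (suc n))) → AllPairs Fin._<_ ps → All (λ p → 0 < toℕ p) ps →
  ∃ λ qs → ps ≡ map Fin.suc qs × AllPairs Fin._<_ qs
shift []               []         []          = [] , refl , []
shift (Fin.suc p ∷ ps) (p< ∷ ps↗) (_ ∷ 0<ps) with shift ps ps↗ 0<ps
... | qs , refl , qs↗ = p ∷ qs , refl , All.map s≤s⁻¹ (All.map⁻ p<) ∷ qs↗

-- Increasing positions use the first letter at most once, at their head; all others are positive
-- and can be shifted down to the rest of the word.
positions⇒sublist : ∀ (w : Vec (Fin k) n) ps → AllPairs Fin._<_ ps → map (letter w) ps ⊆ letters w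
positive⇒sublist  : ∀ x (w : Vec (Fin k) n) ps → AllPairs Fin._<_ ps → All (λ p → 0 < toℕ p) ps →
  map (letter (x ∷ w)) ps ⊆ letters w
positions⇒sublist w       []                 _            = minimum (letters w)
positions⇒sublist (x ∷ w) (Fin.zero ∷ ps)    (0<ps ∷ ps↗) = refl ∷ positive⇒sublist x w ps ps↗ 0<ps
positions⇒sublist (x ∷ w) ps@(Fin.suc _ ∷ _) ps↗@(p< ∷ _) =
  _ ∷ʳ positive⇒sublist x w ps ps↗ (s≤s z≤n ∷ All.map (≤-trans (s≤s z≤n)) p<)
positive⇒sublist x w ps ps↗ 0<ps with shift ps ps↗ 0<ps
... | qs , refl , qs↗ = subst (_⊆ letters w) (map-∘ qs) (positions⇒sublist w qs qs↗)

sublist⇒positions : ∀ (w : Vec (Fin k) n) {xs} → xs ⊆ letters w →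
  ∃ λ ps → AllPairs Fin._<_ ps × map (letter w) ps ≡ xs
sublist⇒positions []      []         = [] , [] , refl
sublist⇒positions (x ∷ w) (_ ∷ʳ τ)   with sublist⇒positions w τ
... | ps , ps↗ , eq = map Fin.suc ps , AllPairs.map⁺ (AllPairs.map s≤s ps↗) , trans (sym (map-∘ ps)) eq
sublist⇒positions (x ∷ w) (refl ∷ τ) with sublist⇒positions w τ
... | ps , ps↗ , eq = Fin.zero ∷ map Fin.suc ps ,
  (All.map⁺ (All.universal (λ _ → s≤s z≤n) ps) ∷ AllPairs.map⁺ (AllPairs.map s≤s ps↗)) ,
  cong (_ ∷_) (trans (sym (map-∘ ps)) eq)

nonCrossing⇒avoids : ∀ (w : Vec (Fin k) n) → NonCrossing w →
  ∀ {a b} → a < b → ¬ (a ∷ b ∷ a ∷ b ∷ [] ⊆ letters w)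
nonCrossing⇒avoids w nc a<b τ with sublist⇒positions w τ
... | p ∷ q ∷ r ∷ t ∷ [] , (p<q ∷ _) ∷ (q<r ∷ _) ∷ (r<t ∷ _) ∷ _ , eq =
  nc (p , q , r , t , p<q , q<r , r<t , same p≡ r≡ , same q≡ t≡ , s≤s⁻¹ (subst₂ _<_ (sym p≡) (sym q≡) a<b))
  where
  same : ∀ {i j x} → letter w i ≡ x → letter w j ≡ x → Vec.lookup w i ≡ Vec.lookup w j
  same i≡ j≡ = toℕ-injective (suc-injective (trans i≡ (sym j≡)))
  p≡ = ∷-injectiveˡ eq
  q≡ = ∷-injectiveˡ (∷-injectiveʳ eq)
  r≡ = ∷-injectiveˡ (∷-injectiveʳ (∷-injectiveʳ eq))
  t≡ = ∷-injectiveˡ (∷-injectiveʳ (∷-injectiveʳ (∷-injectiveʳ eq)))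

avoids⇒nonCrossing : ∀ (w : Vec (Fin k) n) →
  (∀ {a b} → a < b → ¬ (a ∷ b ∷ a ∷ b ∷ [] ⊆ letters w)) → NonCrossing w
avoids⇒nonCrossing w avoids (p , q , r , t , p<q , q<r , r<t , p≡r , q≡t , p<q′) =
  avoids (s≤s p<q′) (subst₂ (λ x y → letter w p ∷ letter w q ∷ x ∷ y ∷ [] ⊆ letters w)
    (cong (suc ∘ toℕ) (sym p≡r)) (cong (suc ∘ toℕ) (sym q≡t))
    (positions⇒sublist w (p ∷ q ∷ r ∷ t ∷ [])
      ((p<q ∷ <-trans p<q q<r ∷ <-trans p<q (<-trans q<r r<t) ∷ [])
       ∷ (q<r ∷ <-trans q<r r<t ∷ []) ∷ (r<t ∷ []) ∷ [] ∷ [])))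

-- Comparison of the two lists of words

∈-words : ∀ (w : Vec (Fin k) n) → w ∈ words k n
∈-words []      = here refl
∈-words (x ∷ w) = ∈-cartesianProductWith⁺ _∷_ (∈-allFin x) (∈-words w)

words-unique : ∀ k n → Unique (words k n)
words-unique k zero    = [] ∷ []
words-unique k (suc n) = Unique.cartesianProductWith⁺ _∷_ ∷-injective (Unique.allFin⁺ k) (words-unique k n)

module _ (n : ℕ) where

  private
    valid? : (w : Vec (Fin k) n) → Dec (IsCanonicalForm w × NonCrossing w)
    valid? w = isCanonicalForm? w ×-dec nonCrossing? w

    NCᵏ : ℕ → List (List ℕ)
    NCᵏ k = map letters (filter valid? (words k n))

  ∈-NCᵏ⁻ : u ∈ NCᵏ k → ∃ λ (w : Vec (Fin k) n) → u ≡ letters w × IsCanonicalForm w × NonCrossing w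
  ∈-NCᵏ⁻ {k = k} u∈ with ∈-map⁻ letters u∈
  ... | w , w∈ , eq = w , eq , proj₂ (∈-filter⁻ valid? {xs = words k n} w∈)

  NC-unique : Unique (NC n)
  NC-unique = Unique.concat⁺
    (All.map⁺ (All.universal
      (λ k → Unique.map⁺ (letters-injective _ _) (Unique.filter⁺ valid? (words-unique k n))) (upTo (suc n))))
    (AllPairs.map⁺ (AllPairs.map disjoint (Unique.upTo⁺ (suc n))))
    where
    disjoint : ∀ {k k′} → k ≢ k′ → ∀ {u} → ¬ (u ∈ NCᵏ k × u ∈ NCᵏ k′)
    disjoint k≢k′ (u∈ , u∈′) with ∈-NCᵏ⁻ u∈ | ∈-NCᵏ⁻ u∈′
    ... | w , refl , c , _ | w′ , eq , c′ , _ = k≢k′ (restricted-deterministic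
      (canonical⇒restricted w c)
      (subst (λ u → Restricted 0 u _) (sym eq) (canonical⇒restricted w′ c′)))

  NC⇒extensions : u ∈ NC n → u ∈ extensions n [] 0
  NC⇒extensions u∈ with find (∈-concatMap⁻ NCᵏ {xs = upTo (suc n)} u∈)
  ... | k , _ , u∈ᵏ with ∈-NCᵏ⁻ u∈ᵏ
  ...   | w , refl , c , nc = subst (λ l → letters w ∈ extensions l [] 0) (length-letters w)
    (continues⇒∈ (compatible⇒continues ([] ∷ []) (canonical⇒restricted w c) compatible))
    where
    compatible : Compatible [] 0 (letters w)
    -- With `M = 0` the conditions on letters at most `M` are vacuous, as letters start from 1; only
    -- `abab` has content.
    compatible .reuses i z≤n          = contradiction i (letters-positive w)
    compatible .avoids-ab () z≤n
    compatible .avoids-bab a<b z≤n τ  = letters-positive w (Sublist.lookup τ (there (here refl)))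
    compatible .avoids-abab           = nonCrossing⇒avoids w nc

  continues⇒NC : ∀ (w : Vec (Fin K) n) → K ≤ n →
    Restricted 0 (letters w) K → Continues [] 0 (letters w) → letters w ∈ NC n
  continues⇒NC w K≤n r c = ∈-concatMap⁺ NCᵏ (lose (∈-upTo⁺ (s≤s K≤n)) (∈-map⁺ letters
    (∈-filter⁺ valid? (∈-words w) (restricted⇒canonical w r ,
      avoids⇒nonCrossing w λ a<b → continues-avoids-abab a<b ([] ∷ []) c))))

  extensions⇒NC : u ∈ extensions n [] 0 → u ∈ NC n
  extensions⇒NC {u} u∈ with ∈⇒continues n [] 0 u∈
  ... | refl , c with continues⇒restricted ([] ∷ []) c
  -- The number `K` of distinct letters is the number of blocks. It is at most the length, so it
  -- lies in the range that `NC` runs through.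
  ...   | K , r with letters-surjective K u (All.tabulate λ x∈ → positive x∈ , restricted-letters r x∈)
    where
    positive : x ∈ u → 0 < x
    positive {zero}  x∈ with () ← continues-old ([] ∷ []) c x∈ z≤n
    positive {suc x} x∈ = s≤s z≤n
  ...     | w , eq = subst (_∈ NC n) eq (continues⇒NC w
    (≤-trans (restricted-length r) (≤-reflexive (+-identityʳ n)))
    (subst (λ u → Restricted 0 u K) (sym eq) r) (subst (Continues [] 0) (sym eq) c))

  NC↭extensions : NC n ↭ extensions n [] 0
  NC↭extensions = ∼bag⇒↭ (unique∧set⇒bag NC-unique (extensions-unique n [] 0 ([] ∷ []))
    (mk⇔ NC⇒extensions extensions⇒NC))

-- The closed form over the rationals

open import Data.Integer.Base using (+_)

totalOccurrences-slope : ∀ j a k →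
  totalOccurrences (1 ∷ slope j a 1) (suc (j + a + k)) ≡ (2 * k + j + 2) C k
totalOccurrences-slope j a k =
  trans (sum-↭ (map⁺ (μ (1 ∷ slope j a 1)) (NC↭extensions (suc (j + a + k))))) (sumOver-extensions-μ j a k)

-- `ℚ._/_` reduces to lowest terms, so the equation is transferred to unnormalised rationals, where
-- equality is cross-multiplication.
cross-multiply : ∀ t r d b .{{_ : NonZero d}} → d * t ≡ r * b →
  (+ t) ℚ./ 1 ≡ ((+ r) ℚ./ d) ℚ.* ((+ b) ℚ./ 1)
cross-multiply t r (suc d) b eq = ℚ.toℚᵘ-injective (begin
  ℚ.toℚᵘ ((+ t) ℚ./ 1)                                   ≈⟨ ℚ.toℚᵘ-fromℚᵘ (ℚᵘ.mkℚᵘ (+ t) 0) ⟩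
  ℚᵘ.mkℚᵘ (+ t) 0                                        ≈⟨ ℚᵘ.*≡* numerators ⟩
  ℚᵘ.mkℚᵘ (+ r) d ℚᵘ.* ℚᵘ.mkℚᵘ (+ b) 0                   ≈⟨ ℚᵘ.*-cong (ℚ.toℚᵘ-fromℚᵘ (ℚᵘ.mkℚᵘ (+ r) d)) (ℚ.toℚᵘ-fromℚᵘ (ℚᵘ.mkℚᵘ (+ b) 0)) ⟨
  ℚ.toℚᵘ ((+ r) ℚ./ suc d) ℚᵘ.* ℚ.toℚᵘ ((+ b) ℚ./ 1)     ≈⟨ ℚ.toℚᵘ-homo-* ((+ r) ℚ./ suc d) ((+ b) ℚ./ 1) ⟨
  ℚ.toℚᵘ ((+ r) ℚ./ suc d ℚ.* ((+ b) ℚ./ 1))             ∎)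
  where
  open ℚᵘ.≃-Reasoning
  numerators : (+ t) ℤ.* (+ (suc d * 1)) ≡ ((+ r) ℤ.* (+ b)) ℤ.* (+ 1)
  numerators = trans (sym (ℤ.pos-* t (suc d * 1))) (trans
    (cong +_ (trans (cong (t *_) (*-identityʳ (suc d))) (trans (*-comm t (suc d)) eq)))
    (trans (ℤ.pos-* r b) (sym (ℤ.*-identityʳ ((+ r) ℤ.* (+ b))))))

corollary11 : ∀ (a m n : ℕ) → 2 ≤ a → (2≤m : 2 ≤ m) → a + m ∸ 1 ≤ n →
    let r = (n + 2) ∸ (a + m) in
    (+ totalOccurrences (risePlateau m a) n) ℚ./ 1
    ≡ ((ℚ._/_ (+ r) (2 * r + m) {{2r+m-nonZero r 2≤m}}) ℚ.* ((+ ((2 * r + m) C r)) ℚ./ 1))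
corollary11 (suc a) (suc j) n _ 2≤m bound =
  cross-multiply _ r (2 * r + suc j) _ {{2r+m-nonZero r 2≤m}} (begin
    (2 * r + suc j) * totalOccurrences (risePlateau (suc j) (suc a)) n
      ≡⟨ cong₂ _*_ denominator (trans (cong₂ totalOccurrences (risePlateau≡slope j a) n≡)
           (totalOccurrences-slope j a q)) ⟩
    suc (2 * q + j + 2) * ((2 * q + j + 2) C q)
      -- This is (2r+m) C(2r+m-1, r-1) = r C(2r+m, r).
      ≡⟨ absorption (2 * q + j + 2) q ⟨
    suc q * (suc (2 * q + j + 2) C suc q)
      ≡⟨ cong₂ (λ d r → r * (d C r)) denominator r≡ ⟨
    r * ((2 * r + suc j) C r) ∎)
  where
  open ≡-Reasoning
  r = (n + 2) ∸ (suc a + suc j)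
  -- The plateau has `suc a` letters, so `q` is `r − 1`, the number of letters left after an
  -- occurrence at the very start. `bound` makes the truncated differences exact.
  q = n ∸ (a + suc j)
  rearrange : ∀ a j q → a + suc j + q ≡ suc (j + a + q)
  rearrange = solve-∀
  n≡ : n ≡ suc (j + a + q)
  n≡ = trans (sym (m+[n∸m]≡n bound)) (rearrange a j q)
  r≡ : r ≡ suc q
  r≡ = trans (cong (_∸ (suc a + suc j)) (+-comm n 2)) (+-∸-assoc 1 bound)
  denominator : 2 * r + suc j ≡ suc (2 * q + j + 2)
  denominator = trans (cong (λ r → 2 * r + suc j) r≡) (expand q j)
    where
    expand : ∀ q j → 2 * suc q + suc j ≡ suc (2 * q + j + 2)
    expand = solve-∀
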